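{- Assume Vopěnka's Principle. Let $R$ be a ring and let $(\mathcal{A},\mathcal{B})$ be a cotorsion pair of $R$-modules such that ${}^\perp B$ is downward closed under elementary submodules for every $B\in\mathcal{B}$. Then $(\mathcal{A},\mathcal{B})$ is cogenerated by a set.
   Context: The background theory is ZFC. Modules are left $R$-modules. For a class $\mathcal{C}$ of $R$-modules, ${}^\perp\mathcal{C}=\{X : \mathrm{Ext}^1_R(X,C)=0 \text{ for all } C\in\mathcal{C}\}$ and $\mathcal{C}^\perp=\{Y : \mathrm{Ext}^1_R(C,Y)=0\text{ for all }C\in\mathcal{C}\}$; for a single module $B$, ${}^\perp B={}^\perp\{B\}$. A cotorsion pair is a pair $(\mathcal{A},\mathcal{B})$ of classes of $R$-modules with $\mathcal{A}={}^\perp\mathcal{B}$ and $\mathcal{B}=\mathcal{A}^\perp$. It is cogenerated by a set if there is a set (not a proper class) $\mathcal{C}$ of $R$-modules with $(\mathcal{A},\mathcal{B})=({}^\perp\mathcal{C},({}^\perp\mathcal{C})^\perp)$. The language of $R$-modules is the language of abelian groups together with a unary function symbol for scalar multiplication by $r$, for each $r\in R$. An elementary submodule is an elementary substructure in this language. A class $\mathcal{K}$ of modules is downward closed under elementary submodules if $M\in\mathcal{K}$ and $N\prec M$ imply $N\in\mathcal{K}$. Vopěnka's Principle is the axiom scheme asserting that for every proper class (definable with parameters) of structures in a common first-order signature (a set), there are two distinct members of the class with an elementary embedding from one into the other. Classes are definable with parameters, and assertions about all classes are understood as schemes. -}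

module Defs where

open import Algebra.Bundles using (Ring)
open import Algebra.Module.Bundles using (LeftModule; RawLeftModule)
import Algebra.Module.Construct.DirectProduct as Product
import Algebra.Module.Morphism.Construct.Composition as Composition
import Algebra.Module.Morphism.Construct.Identity as Identity
import Algebra.Module.Morphism.LeftModuleMonomorphism as LeftModuleMonomorphism
open import Algebra.Module.Morphism.Structures
  using (IsLeftModuleHomomorphism; IsLeftModuleMonomorphism; IsLeftModuleIsomorphism)
open import Data.Empty.Polymorphic using (⊥)
open import Data.Fin.Patterns using (0F; 1F)
open import Data.Fin.Base using (Fin)
open import Data.Nat.Base using (ℕ; suc)
open import Data.Product.Base using (Σ-syntax; ∃; ∃-syntax; ∃₂; _×_; _,_; proj₁; proj₂)
open import Data.Vec.Functional using (Vector; _∷_)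
open import Function.Base using (_∘_; id)
open import Function.Bundles using (_⇔_; mk⇔)
open import Level using (Level; Setω; _⊔_) renaming (suc to lsuc)
open import Relation.Binary.Bundles using (Setoid)
open import Relation.Binary.PropositionalEquality.Core using (_≡_; _≢_)
open import Relation.Nullary.Negation.Core using (¬_)
open import Relation.Unary using (Pred; _≐_)

-- Sets and classes.  The types in `Set u` play the role of the sets of the
-- background set theory, and a class of objects of type A is a predicate on A,
-- in any universe.  A statement schematic in a definable class becomes a
-- quantification over predicates.

Range : ∀ {i a} {I : Set i} {A : Set a} → (I → A) → Pred A (i ⊔ a)
Range F x = ∃[ i ] F i ≡ x

IsSet : ∀ (u : Level) {a ℓ} {A : Set a} → Pred A ℓ → Set (lsuc u ⊔ a ⊔ ℓ)
IsSet u {A = A} P = Σ[ I ∈ Set u ] Σ[ F ∈ (I → A) ] P ≐ Range F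

IsProperClass : ∀ (u : Level) {a ℓ} {A : Set a} → Pred A ℓ → Set (lsuc u ⊔ a ⊔ ℓ)
IsProperClass u P = ¬ IsSet u P

------------------------------------------------------------------------
-- First-order logic

-- Symbols are indexed by their arity.
record Signature (u : Level) : Set (lsuc u) where
  field
    Fun : ℕ → Set u
    Rel : ℕ → Set u

-- As for the algebraic bundles of the library, the equality of a structure is
-- an equivalence relation on its carrier, and `≐′` below is interpreted by it.
record Structure {u} (σ : Signature u) : Set (lsuc u) where
  open Signature σ
  field
    setoid : Setoid u u
  open Setoid setoid public
  field
    fun      : ∀ {n} → Fun n → Vector Carrier n → Carrier
    fun-cong : ∀ {n} (f : Fun n) {xs ys : Vector Carrier n} →
               (∀ i → xs i ≈ ys i) → fun f xs ≈ fun f ys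
    rel      : ∀ {n} → Rel n → Vector Carrier n → Set u
    rel-resp : ∀ {n} (r : Rel n) {xs ys : Vector Carrier n} →
               (∀ i → xs i ≈ ys i) → rel r xs → rel r ys

module _ {u} (σ : Signature u) where
  open Signature σ

  data Term (n : ℕ) : Set u where
    var : Fin n → Term n
    app : ∀ {k} → Fun k → Vector (Term n) k → Term n

  -- `Formula n`: the free variables are among n de Bruijn indices.  The other
  -- connectives and ∃ are definable, since the logic is classical.
  data Formula (n : ℕ) : Set u where
    falsum : Formula n
    _≐′_   : Term n → Term n → Formula n
    atom   : ∀ {k} → Rel k → Vector (Term n) k → Formula n
    _⇒_    : Formula n → Formula n → Formula n
    all    : Formula (suc n) → Formula n

module _ {u} {σ : Signature u} where

  module _ (M : Structure σ) where
    open Structure M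

    eval : ∀ {n} → Vector Carrier n → Term σ n → Carrier
    eval ρ (var i)    = ρ i
    eval ρ (app f ts) = fun f (λ i → eval ρ (ts i))

    Sat : ∀ {n} → Formula σ n → Vector Carrier n → Set u
    Sat falsum      ρ = ⊥
    Sat (s ≐′ t)    ρ = eval ρ s ≈ eval ρ t
    Sat (atom r ts) ρ = rel r (λ i → eval ρ (ts i))
    Sat (φ ⇒ ψ)     ρ = Sat φ ρ → Sat ψ ρ
    Sat (all φ)     ρ = ∀ x → Sat φ (x ∷ ρ)

  module _ (M N : Structure σ) where
    private
      module M = Structure M
      module N = Structure N

    -- That f respects and reflects the equalities is the case φ = (x ≐′ y).
    IsElementary : (M.Carrier → N.Carrier) → Set u
    IsElementary f =
      ∀ {n} (φ : Formula σ n) (ρ : Vector M.Carrier n) → Sat M φ ρ ⇔ Sat N φ (f ∘ ρ)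

    ElementaryEmbedding : Set u
    ElementaryEmbedding = Σ[ f ∈ (M.Carrier → N.Carrier) ] IsElementary f

-- Distinctness is literal (≢), as is the notion of a set of structures.  For
-- classical logic this is equivalent to reading both up to isomorphism: a proper
-- class that is a set up to isomorphism has two distinct isomorphic members.
VopěnkaPrinciple : Level → Setω
VopěnkaPrinciple u =
  ∀ {ℓ} (σ : Signature u) (𝒦 : Pred (Structure σ) ℓ) → IsProperClass u 𝒦 →
  ∃₂ λ M N → 𝒦 M × 𝒦 N × M ≢ N × ElementaryEmbedding M N

------------------------------------------------------------------------
-- Modules

module _ {u} (R : Ring u u) where
  private
    module R = Ring R

  Module : Set (lsuc u)
  Module = LeftModule R u u

  data ModuleFun : ℕ → Set u where
    zero  : ModuleFun 0
    plus  : ModuleFun 2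
    minus : ModuleFun 1
    scale : R.Carrier → ModuleFun 1

  moduleSignature : Signature u
  moduleSignature = record { Fun = ModuleFun ; Rel = λ _ → ⊥ }

  asStructure : Module → Structure moduleSignature
  asStructure M = record
    { setoid   = record { isEquivalence = ≈ᴹ-isEquivalence }
    ; fun      = λ where
        zero      xs → 0ᴹ
        plus      xs → xs 0F +ᴹ xs 1F
        minus     xs → -ᴹ (xs 0F)
        (scale r) xs → r *ₗ xs 0F
    ; fun-cong = λ where
        zero      e → ≈ᴹ-refl
        plus      e → +ᴹ-cong (e 0F) (e 1F)
        minus     e → -ᴹ‿cong (e 0F)
        (scale r) e → *ₗ-cong R.refl (e 0F)
    ; rel      = λ ()
    ; rel-resp = λ ()
    }
    where open LeftModule M

  module _ (M N : Module) where
    private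
      module M = LeftModule M
      module N = LeftModule N

    IsHom IsMono IsIso : (M.Carrierᴹ → N.Carrierᴹ) → Set u
    IsHom  = IsLeftModuleHomomorphism M.rawLeftModule N.rawLeftModule
    IsMono = IsLeftModuleMonomorphism M.rawLeftModule N.rawLeftModule
    IsIso  = IsLeftModuleIsomorphism  M.rawLeftModule N.rawLeftModule

  ----------------------------------------------------------------------
  -- Submodules

  record Submodule (M : Module) : Set (lsuc u) where
    open LeftModule M
    field
      Member     : Pred Carrierᴹ u
      resp       : ∀ {x y} → x ≈ᴹ y → Member x → Member y
      0-closed   : Member 0ᴹ
      +-closed   : ∀ {x y} → Member x → Member y → Member (x +ᴹ y)
      neg-closed : ∀ {x} → Member x → Member (-ᴹ x)
      *-closed   : ∀ r {x} → Member x → Member (r *ₗ x)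

    raw : RawLeftModule R.Carrier u u
    raw = record
      { Carrierᴹ = ∃ Member
      ; _≈ᴹ_     = λ (x , _) (y , _) → x ≈ᴹ y
      ; _+ᴹ_     = λ (x , p) (y , q) → x +ᴹ y , +-closed p q
      ; _*ₗ_     = λ r (x , p) → r *ₗ x , *-closed r p
      ; 0ᴹ       = 0ᴹ , 0-closed
      ; -ᴹ_      = λ (x , p) → -ᴹ x , neg-closed p
      }

    inclusion-isMono : IsLeftModuleMonomorphism raw rawLeftModule proj₁
    inclusion-isMono = record
      { isLeftModuleHomomorphism = record
        { +ᴹ-isGroupHomomorphism = record
          { isMonoidHomomorphism = record
            { isMagmaHomomorphism = record
              { isRelHomomorphism = record { cong = id }
              ; homo = λ _ _ → ≈ᴹ-refl
              }
            ; ε-homo = ≈ᴹ-refl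
            }
          ; ⁻¹-homo = λ _ → ≈ᴹ-refl
          }
        ; *ₗ-homo = λ _ _ → ≈ᴹ-refl
        }
      ; injective = id
      }

    toModule : Module
    toModule = record
      { isLeftModule =
          LeftModuleMonomorphism.isLeftModule inclusion-isMono R.isRing isLeftModule
      }

  IsElementarySubmodule : {M : Module} → Submodule M → Set u
  IsElementarySubmodule {M} N =
    IsElementary (asStructure (Submodule.toModule N)) (asStructure M) proj₁

  ClosedUnderElementarySubmodules : ∀ {ℓ} → Pred Module ℓ → Set (lsuc u ⊔ ℓ)
  ClosedUnderElementarySubmodules 𝒦 =
    ∀ (M : Module) (N : Submodule M) → 𝒦 M → IsElementarySubmodule N →
    𝒦 (Submodule.toModule N)

  ----------------------------------------------------------------------
  -- Ext¹(X , C), as the equivalence classes of extensions 0 → C → E → X → 0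
  -- (Yoneda), with the split extension as its zero element

  record Extension (X C : Module) : Set (lsuc u) where
    private
      module X = LeftModule X
      module C = LeftModule C
    field
      E : Module
    module E = LeftModule E
    field
      ι      : C.Carrierᴹ → E.Carrierᴹ
      π      : E.Carrierᴹ → X.Carrierᴹ
      ι-mono : IsMono C E ι
      π-hom  : IsHom E X π
      π-surj : ∀ x → ∃[ e ] π e X.≈ᴹ x
      exact  : ∀ e → (π e X.≈ᴹ X.0ᴹ) ⇔ (∃[ c ] ι c E.≈ᴹ e)

  module _ {X C : Module} where
    private
      module X = LeftModule X
      module C = LeftModule C

    record _∼_ (S T : Extension X C) : Set u where
      private
        module S = Extension S
        module T = Extension T
      field
        f     : S.E.Carrierᴹ → T.E.Carrierᴹ
        f-iso : IsIso S.E T.E f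
        f-ι   : ∀ c → f (S.ι c) T.E.≈ᴹ T.ι c
        f-π   : ∀ e → T.π (f e) X.≈ᴹ S.π e

    ∼-refl : ∀ {S} → S ∼ S
    ∼-refl {S} = record
      { f     = id
      ; f-iso = Identity.isLeftModuleIsomorphism S.E.rawLeftModule S.E.≈ᴹ-refl
      ; f-ι   = λ _ → S.E.≈ᴹ-refl
      ; f-π   = λ _ → X.≈ᴹ-refl
      }
      where module S = Extension S

    ∼-sym : ∀ {S T} → S ∼ T → T ∼ S
    ∼-sym {S} {T} e = record
      { f     = g
      ; f-iso = record
        { isLeftModuleMonomorphism = record
          { isLeftModuleHomomorphism = record
            { +ᴹ-isGroupHomomorphism = record
              { isMonoidHomomorphism = record
                { isMagmaHomomorphism = record
                  { isRelHomomorphism = record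
                    { cong = λ p → F.injective (T.trans (fg _) (T.trans p (T.sym (fg _)))) }
                  ; homo = λ x y → F.injective (T.trans (fg _) (T.sym
                      (T.trans (F.+ᴹ-homo _ _) (T′.+ᴹ-cong (fg _) (fg _)))))
                  }
                ; ε-homo = F.injective (T.trans (fg _) (T.sym F.0ᴹ-homo))
                }
              ; ⁻¹-homo = λ x → F.injective (T.trans (fg _) (T.sym
                  (T.trans (F.-ᴹ-homo _) (T′.-ᴹ‿cong (fg _)))))
              }
            ; *ₗ-homo = λ r x → F.injective (T.trans (fg _) (T.sym
                (T.trans (F.*ₗ-homo r _) (T′.*ₗ-cong R.refl (fg _)))))
            }
          ; injective = λ p → T.trans (T.sym (fg _)) (T.trans (F.⟦⟧-cong p) (fg _))
          }
        ; surjective = λ x → f x , λ p → F.injective (T.trans (fg _) p)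
        }
      ; f-ι   = λ c → F.injective (T.trans (fg _) (T.sym (f-ι c)))
      ; f-π   = λ x → X.≈ᴹ-trans (X.≈ᴹ-sym (f-π (g x)))
                        (IsLeftModuleHomomorphism.⟦⟧-cong (Extension.π-hom T) (fg x))
      }
      where
      open _∼_ e
      module S′ = LeftModule (Extension.E S)
      module T′ = LeftModule (Extension.E T)
      module T where
        trans = T′.≈ᴹ-trans
        sym   = T′.≈ᴹ-sym
      module F = IsLeftModuleIsomorphism f-iso
      g : T′.Carrierᴹ → S′.Carrierᴹ
      g y = proj₁ (F.surjective y)
      fg : ∀ y → f (g y) T′.≈ᴹ y
      fg y = proj₂ (F.surjective y) S′.≈ᴹ-refl

    ∼-trans : ∀ {S T U} → S ∼ T → T ∼ U → S ∼ U
    ∼-trans {U = U} d e = record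
      { f     = E.f ∘ D.f
      ; f-iso = Composition.isLeftModuleIsomorphism U.E.≈ᴹ-trans D.f-iso E.f-iso
      ; f-ι   = λ c → U.E.≈ᴹ-trans
                  (IsLeftModuleIsomorphism.⟦⟧-cong E.f-iso (D.f-ι c)) (E.f-ι c)
      ; f-π   = λ x → X.≈ᴹ-trans (E.f-π (D.f x)) (D.f-π x)
      }
      where
      module U = Extension U
      module D = _∼_ d
      module E = _∼_ e

  Ext¹ : Module → Module → Setoid (lsuc u) u
  Ext¹ X C = record
    { Carrier       = Extension X C
    ; _≈_           = _∼_
    ; isEquivalence = record { refl = ∼-refl ; sym = ∼-sym ; trans = ∼-trans }
    }

  0-Ext¹ : ∀ {X C} → Setoid.Carrier (Ext¹ X C)
  0-Ext¹ {X} {C} = record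
    { E      = Product.leftModule C X
    ; ι      = λ c → c , X.0ᴹ
    ; π      = proj₂
    ; ι-mono = record
      { isLeftModuleHomomorphism = record
        { +ᴹ-isGroupHomomorphism = record
          { isMonoidHomomorphism = record
            { isMagmaHomomorphism = record
              { isRelHomomorphism = record { cong = λ p → p , X.≈ᴹ-refl }
              ; homo = λ _ _ → C.≈ᴹ-refl , X.≈ᴹ-sym (X.+ᴹ-identityˡ X.0ᴹ)
              }
            ; ε-homo = C.≈ᴹ-refl , X.≈ᴹ-refl
            }
          ; ⁻¹-homo = λ _ → C.≈ᴹ-refl ,
              X.≈ᴹ-trans (X.≈ᴹ-sym (X.-ᴹ‿inverseʳ X.0ᴹ)) (X.+ᴹ-identityˡ _)
          }
        ; *ₗ-homo = λ r _ → C.≈ᴹ-refl , X.≈ᴹ-sym (X.*ₗ-zeroʳ r)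
        }
      ; injective = proj₁
      }
    ; π-hom  = record
      { +ᴹ-isGroupHomomorphism = record
        { isMonoidHomomorphism = record
          { isMagmaHomomorphism = record
            { isRelHomomorphism = record { cong = proj₂ }
            ; homo = λ _ _ → X.≈ᴹ-refl
            }
          ; ε-homo = X.≈ᴹ-refl
          }
        ; ⁻¹-homo = λ _ → X.≈ᴹ-refl
        }
      ; *ₗ-homo = λ _ _ → X.≈ᴹ-refl
      }
    ; π-surj = λ x → (C.0ᴹ , x) , X.≈ᴹ-refl
    ; exact  = λ (c , x) → mk⇔ (λ p → c , C.≈ᴹ-refl , X.≈ᴹ-sym p)
                               (λ (_ , _ , p) → X.≈ᴹ-sym p)
    }
    where
    module X = LeftModule X
    module C = LeftModule C

  Ext¹-vanishes : Module → Module → Set (lsuc u)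
  Ext¹-vanishes X C = ∀ (S : Carrier) → S ≈ 0-Ext¹
    where open Setoid (Ext¹ X C)

  ----------------------------------------------------------------------
  -- Cotorsion pairs

  infix 8 ⊥ˡ_ _⊥ʳ

  ⊥ˡ_ : ∀ {ℓ} → Pred Module ℓ → Pred Module (lsuc u ⊔ ℓ)
  (⊥ˡ 𝒞) X = ∀ C → 𝒞 C → Ext¹-vanishes X C

  _⊥ʳ : ∀ {ℓ} → Pred Module ℓ → Pred Module (lsuc u ⊔ ℓ)
  (𝒞 ⊥ʳ) Y = ∀ C → 𝒞 C → Ext¹-vanishes C Y

  record IsCotorsionPair {a b} (𝒜 : Pred Module a) (ℬ : Pred Module b)
                         : Set (lsuc u ⊔ a ⊔ b) where
    field
      left  : 𝒜 ≐ ⊥ˡ ℬ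
      right : ℬ ≐ 𝒜 ⊥ʳ

  CogeneratedBySet : ∀ {a b} → Pred Module a → Pred Module b → Set (lsuc (lsuc u) ⊔ a ⊔ b)
  CogeneratedBySet 𝒜 ℬ =
    Σ[ 𝒞 ∈ Pred Module (lsuc u) ] IsSet u 𝒞 × 𝒜 ≐ ⊥ˡ 𝒞 × ℬ ≐ (⊥ˡ 𝒞) ⊥ʳ

{-# OPTIONS --safe #-}
module Submission where

-- The size of a module is its carrier setoid up to injections.  Call a module M of a
-- class 𝒦 minimal if no smaller member of 𝒦 embeds elementarily into M.  Sizes are
-- well-founded, so some minimal module embeds elementarily into each member of 𝒦.  One
-- minimal module of each size gives a class without elementary embeddings between
-- distinct members, hence a set by Vopěnka's principle.  So the sizes of minimal
-- modules are bounded, and up to isomorphism there is only a set of them.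
--
-- Let 𝒦 be the complement of 𝒜, and choose for each of these minimal modules F a
-- B ∈ ℬ with Ext¹(F , B) ≠ 0.  The chosen B cogenerate the pair: if M ∉ 𝒜, some F
-- embeds elementarily into M, and Ext¹(M , B) = 0 would yield Ext¹(F , B) = 0.

open import Defs
open import Algebra.Bundles using (Ring)
open import Algebra.Module.Bundles using (LeftModule; RawLeftModule)
import Algebra.Module.Morphism.Construct.Composition as Composition
import Algebra.Module.Morphism.LeftModuleMonomorphism as LeftModuleMonomorphism
open import Algebra.Module.Morphism.Structures
  using (IsLeftModuleHomomorphism; IsLeftModuleMonomorphism; IsLeftModuleIsomorphism)
open import Algebra.Module.Structures using (IsLeftModule)
open import Axiom.ExcludedMiddle using (ExcludedMiddle)
open import Axiom.Extensionality.Propositional using (Extensionality)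
open import Data.Bool.Base using (Bool; true; T)
open import Data.Bool.Properties using (T-≡; ⇔→≡)
open import Data.Empty.Polymorphic using (⊥)
open import Data.Fin.Base using (zero; suc)
open import Data.Fin.Patterns using (0F; 1F)
open import Data.Product.Base using (Σ-syntax; ∃; ∃-syntax; _×_; _,_; proj₁; proj₂)
open import Data.Sum.Base using (_⊎_; inj₁; inj₂)
open import Data.Vec.Functional using ([]; _∷_)
open import Function.Base using (_∘_; id; _on_)
open import Function.Bundles using (_⇔_; mk⇔; Equivalence; Injection)
import Function.Construct.Composition as Compose
import Function.Construct.Identity as Identity
import Relation.Binary.Construct.On as On
open import Function.Construct.Composition using (_⇔-∘_)
open import Function.Construct.Symmetry using (⇔-sym)
open import Level using (Level; _⊔_)
open import Relation.Binary.Bundles using (Setoid)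
open import Relation.Binary.Core using (Rel)
open import Relation.Binary.Structures using (IsEquivalence)
import Relation.Binary.PropositionalEquality.Core as ≡
open import Relation.Binary.PropositionalEquality.Core using (_≡_; refl)
open import Relation.Nullary.Decidable
  using (Dec; yes; no; isYes; toWitness; fromWitness; decidable-stable)
open import Relation.Nullary.Negation.Core using (¬_; contradiction)
open import Relation.Unary using (Pred; ｛_｝)

private
  variable
    a b c i ℓ : Level

-- Subsets and choice from excluded middle.

module Classical
  (em : ∀ {ℓ} → ExcludedMiddle ℓ) (ext : ∀ {a b} → Extensionality a b)
  where

  stable : {P : Set a} → ¬ ¬ P → P
  stable = decidable-stable em

  ¬∀⇒∃¬ : {A : Set a} {P : A → Set b} → ¬ (∀ x → P x) → ∃[ x ] ¬ P x
  ¬∀⇒∃¬ h = stable λ n → h λ x → stable λ p → n (x , p)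

  -- Subsets are Boolean-valued, so that they form a type at the level of A
  -- (excluded middle makes predicates of any level into subsets).
  Subset : Set a → Set a
  Subset A = A → Bool

  infix 4 _∈_ _⊆_

  -- Opaque, so that the unifier recovers S and P from x ∈ S and x ∈ ⟦ P ⟧.
  opaque
    _∈_ : {A : Set a} → A → Subset A → Set
    x ∈ S = T (S x)

    ⟦_⟧ : {A : Set a} → Pred A ℓ → Subset A
    ⟦ P ⟧ x = isYes (em {P = P x})

    ∈⁺ : {A : Set a} {P : Pred A ℓ} {x : A} → P x → x ∈ ⟦ P ⟧
    ∈⁺ = fromWitness

    ∈⁻ : {A : Set a} {P : Pred A ℓ} {x : A} → x ∈ ⟦ P ⟧ → P x
    ∈⁻ = toWitness

  _⊆_ : {A : Set a} → Subset A → Subset A → Set a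
  S ⊆ S′ = ∀ x → x ∈ S → x ∈ S′

  opaque
    unfolding _∈_

    ⊆-antisym : {A : Set a} {S S′ : Subset A} → S ⊆ S′ → S′ ⊆ S → S ≡ S′
    ⊆-antisym p q = ext λ x → ⇔→≡ {z = true}
      (T-≡ ⇔-∘ (mk⇔ (p x) (q x) ⇔-∘ ⇔-sym T-≡))

  ⋃ : {A : Set a} → Subset (Subset A) → Subset A
  ⋃ D = ⟦ (λ x → ∃[ S ] S ∈ D × x ∈ S) ⟧

  -- Equivalent elements have equal classes by `⊆-antisym`, and excluded middle, applied to an
  -- untruncated existential, chooses from a class in a way that depends on the class alone. The
  -- default `d` is the value at the empty subset.
  canonicalRepresentatives : {A : Set a} {_~_ : Rel A ℓ} → IsEquivalence _~_ →
    Σ[ r ∈ (A → A) ] (∀ x → r x ~ x) × (∀ {x y} → x ~ y → r x ≡ r y)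
  canonicalRepresentatives {A = A} {_~_} eq =
    (λ x → choose (cls x) x) , (λ x → ∈⁻ (choose-∈ (E.refl {x}))) , λ {x} {y} p →
      ≡.trans (choose-irr (cls x) (x , ∈⁺ E.refl))
            (≡.cong (λ S → choose S y) (⊆-antisym (λ z q → ∈⁺ (E.trans (∈⁻ q) p))
                                                (λ z q → ∈⁺ (E.trans (∈⁻ q) (E.sym p)))))
    where
    module E = IsEquivalence eq
    cls : A → Subset A
    cls x = ⟦ _~ x ⟧
    choose : Subset A → A → A
    choose S d with em {P = ∃[ x ] x ∈ S}
    ... | yes (x , _) = x
    ... | no _        = d
    choose-∈ : ∀ {x} → x ~ x → choose (cls x) x ∈ cls x
    choose-∈ {x} p with em {P = ∃[ y ] y ∈ cls x}
    ... | yes (_ , q) = q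
    ... | no _        = ∈⁺ p
    choose-irr : ∀ S {d d′} → ∃ (_∈ S) → choose S d ≡ choose S d′
    choose-irr S h with em {P = ∃[ x ] x ∈ S}
    ... | yes _ = refl
    ... | no ¬h = contradiction h ¬h

  -- Chains of subsets and fixed points.

  IsChain : {A : Set a} → Subset (Subset A) → Set a
  IsChain D = ∀ S S′ → S ∈ D → S′ ∈ D → S ⊆ S′ ⊎ S′ ⊆ S

  -- The Bourbaki–Witt theorem for subsets ordered by inclusion.
  module Tower {A : Set a} (next : Subset A → Subset A) (next-⊇ : ∀ S → S ⊆ next S) where

    data InTower : Subset A → Set a where
      step  : ∀ {S} → InTower S → InTower (next S)
      union : ∀ D → (∀ S → S ∈ D → InTower S) → InTower (⋃ D)

    -- The hypothesis on `U` is the extremality of the classical proof: `next` of a tower member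
    -- strictly below `U` stays inside `U`. The dichotomy then passes through both constructors of
    -- the tower, by induction on `S`.
    gap : ∀ {S U} → InTower S →
      (∀ {V} → InTower V → V ⊆ U → U ≡ V ⊎ next V ⊆ U) → next U ⊆ S ⊎ S ⊆ U
    gap (step {V} t) h with gap t h
    ... | inj₁ p = inj₁ λ x q → next-⊇ V x (p x q)
    ... | inj₂ p with h t p
    ...   | inj₁ refl = inj₁ λ _ → id
    ...   | inj₂ q    = inj₂ q
    gap {U = U} (union D t) h with em {P = ∃[ S ] S ∈ D × next U ⊆ S}
    ... | yes (S , d , p) = inj₁ λ x q → ∈⁺ (S , d , p x q)
    ... | no ¬p = inj₂ λ x q → let (S , d , s) = ∈⁻ q in below S d (gap (t S d) h) x s
      where
      below : ∀ S → S ∈ D → next U ⊆ S ⊎ S ⊆ U → S ⊆ U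
      below S d (inj₁ p) = contradiction (S , d , p) ¬p
      below S d (inj₂ p) = p

    -- Induction on `U`, with `gap` comparing `V` to the earlier stages, discharges the hypothesis
    -- of `gap` for every tower member. In the union case, a member of `D` not contained in `V`
    -- already contains `next V`.
    comparable : ∀ {U V} → InTower U → InTower V → V ⊆ U → U ≡ V ⊎ next V ⊆ U
    comparable (step {U} t) v p with gap v (comparable t)
    ... | inj₁ q = inj₁ (⊆-antisym q p)
    ... | inj₂ q with comparable t v q
    ...   | inj₁ refl = inj₂ λ _ → id
    ...   | inj₂ r    = inj₂ λ x s → next-⊇ U x (r x s)
    comparable {V = V} (union D t) v p with em {P = ∀ S → S ∈ D → S ⊆ V}
    ... | yes q = inj₁ (⊆-antisym (λ x r → let (S , d , s) = ∈⁻ r in q S d x s) p)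
    ... | no ¬q with stable (λ n → ¬q λ S d → stable λ r → n (S , d , r))
    ...   | S , d , r with gap v (comparable (t S d))
    ...     | inj₁ s = contradiction (λ x q → s x (next-⊇ S x q)) r
    ...     | inj₂ s with comparable (t S d) v s
    ...       | inj₁ refl = contradiction (λ _ → id) r
    ...       | inj₂ q    = inj₂ λ x z → ∈⁺ (S , d , q x z)

    total : ∀ {U V} → InTower U → InTower V → U ⊆ V ⊎ V ⊆ U
    total {U} {V} s t with gap s (comparable t)
    ... | inj₁ p = inj₂ λ x q → p x (next-⊇ V x q)
    ... | inj₂ p = inj₁ p

    -- The union of the whole tower is itself a member, so its `next` is a member too and is
    -- contained in it. `P` climbs the tower by induction, with `total` supplying the chain
    -- condition at unions.
    fixedPoint : (P : Subset A → Set b) → (∀ S → P S → P (next S)) →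
      (∀ D → IsChain D → (∀ S → S ∈ D → P S) → P (⋃ D)) →
      ∃[ U ] P U × next U ⊆ U
    fixedPoint P P-next P-⋃ =
      top , tower-P top-tower , λ x p → ∈⁺ (next top , ∈⁺ (step top-tower) , p)
      where
      top = ⋃ ⟦ InTower ⟧
      top-tower : InTower top
      top-tower = union _ λ _ → ∈⁻
      tower-P : ∀ {S} → InTower S → P S
      tower-P (step {S} t) = P-next S (tower-P t)
      tower-P (union D t)  = P-⋃ D (λ S S′ d d′ → total (t S d) (t S′ d′)) (λ S d → tower-P (t S d))

  -- Well-foundedness of the sizes of setoids.

  module _ {I : Set i} (X : I → Setoid c ℓ) where
    private
      module X i = Setoid (X i)
      Point = ∀ i → X.Carrier i

      Separated : Subset Point → Set _
      Separated S = ∀ {x y} → x ∈ S → y ∈ S → ∀ i j → X._≈_ i (x i) (y i) → X._≈_ j (x j) (y j)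

      Apart : Subset Point → Point → Set _
      Apart S y = ∀ i x → x ∈ S → ¬ X._≈_ i (x i) (y i)

      -- At most one point is added at a time, since two points apart from `S` may still agree with
      -- each other at some index.
      New : Subset Point → Pred Point _
      New S y with em {P = ∃ (Apart S)}
      ... | yes (z , _) = y ≡ z
      ... | no _        = ⊥

      New⇒Apart : ∀ S {y} → New S y → Apart S y
      New⇒Apart S n with em {P = ∃ (Apart S)}
      New⇒Apart S refl | yes (_ , p) = p

      New-unique : ∀ S {y z} → New S y → New S z → y ≡ z
      New-unique S n n′ with em {P = ∃ (Apart S)}
      New-unique S refl refl | yes _ = refl

      New-exists : ∀ S → ∃ (Apart S) → ∃ (New S)
      New-exists S h with em {P = ∃ (Apart S)}
      ... | yes (z , _) = z , refl
      ... | no ¬h       = contradiction h ¬h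

      next : Subset Point → Subset Point
      next S = ⟦ (λ y → y ∈ S ⊎ New S y) ⟧

      next-separated : ∀ S → Separated S → Separated (next S)
      next-separated S sep p q i j e with ∈⁻ p | ∈⁻ q
      ... | inj₁ p | inj₁ q = sep p q i j e
      ... | inj₁ p | inj₂ q = contradiction e (New⇒Apart S q i _ p)
      ... | inj₂ p | inj₁ q = contradiction (X.sym i e) (New⇒Apart S p i _ q)
      ... | inj₂ p | inj₂ q with New-unique S p q
      ...   | refl = X.refl j

      ⋃-separated : ∀ D → IsChain D → (∀ S → S ∈ D → Separated S) → Separated (⋃ D)
      ⋃-separated D chain sep p q with ∈⁻ p | ∈⁻ q
      ... | S , d , p | S′ , d′ , q with chain S S′ d d′
      ...   | inj₁ s = sep S′ d′ (s _ p) q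
      ...   | inj₂ s = sep S d p (s _ q)

    -- A maximal set of points of the product on which each projection is injective
    -- projects onto some factor, which then injects into all the others.
    leastSetoid : I → ∃[ i ] ∀ j → Injection (X i) (X j)
    leastSetoid i₀
      with Tower.fixedPoint next (λ S x p → ∈⁺ (inj₁ p)) Separated next-separated ⋃-separated
    ... | U , sep , closed = k , λ j → record
      { to        = λ x → proj₁ (lift x) j
      ; cong      = λ {x} {y} p → sep (proj₁ (proj₂ (lift x))) (proj₁ (proj₂ (lift y))) k j
          (X.trans k (proj₂ (proj₂ (lift x))) (X.trans k p (X.sym k (proj₂ (proj₂ (lift y))))))
      ; injective = λ {x} {y} p →
          X.trans k (X.sym k (proj₂ (proj₂ (lift x))))
            (X.trans k (sep (proj₁ (proj₂ (lift x))) (proj₁ (proj₂ (lift y))) j k p)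
              (proj₂ (proj₂ (lift y))))
      }
      where
      Missed : ∀ i → X.Carrier i → Set _
      Missed i y = ∀ x → x ∈ U → ¬ X._≈_ i (x i) y

      ¬apart : ¬ ∃ (Apart U)
      -- The point that `next` would add lies in `U` already, hence is apart from itself; the index
      -- `i₀` exhibits the contradiction.
      ¬apart h = let (y , n) = New-exists U h in
        New⇒Apart U n i₀ y (closed y (∈⁺ (inj₂ n))) (X.refl i₀)

      onto : ∃[ i ] ¬ ∃ (Missed i)
      -- An element missed in every factor would assemble into a point apart from `U`.
      onto = ¬∀⇒∃¬ λ h → ¬apart ((λ i → proj₁ (h i)) , λ i → proj₂ (h i))

      k = proj₁ onto

      lift : ∀ y → ∃[ x ] x ∈ U × X._≈_ k (x k) y
      lift y = stable λ n → proj₂ onto (y , λ x p e → n (x , p , e))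

-- Isomorphisms and elementary embeddings of structures.

module _ {u} {σ : Signature u} where

  module _ (M N : Structure σ) {f : Structure.Carrier M → Structure.Carrier N} where
    private
      module M = Structure M
      module N = Structure N

    record IsStructureIsomorphism : Set u where
      field
        cong       : ∀ {x y} → x M.≈ y → f x N.≈ f y
        injective  : ∀ {x y} → f x N.≈ f y → x M.≈ y
        surjective : ∀ y → ∃[ x ] f x N.≈ y
        fun-homo   : ∀ {n} (g : Signature.Fun σ n) xs → f (M.fun g xs) N.≈ N.fun g (f ∘ xs)
        rel-homo   : ∀ {n} (r : Signature.Rel σ n) xs → M.rel r xs ⇔ N.rel r (f ∘ xs)

    module _ (iso : IsStructureIsomorphism) where
      open IsStructureIsomorphism iso

      eval-≈ : ∀ {n} (t : Term σ n) {ρ ρ′} → (∀ k → f (ρ k) N.≈ ρ′ k) →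
        f (eval M ρ t) N.≈ eval N ρ′ t
      eval-≈ (var k)    e = e k
      eval-≈ (app g ts) e = N.trans (fun-homo g _) (N.fun-cong g λ k → eval-≈ (ts k) e)

      -- Allowing ρ′ to be any vector equal to f ∘ ρ makes the induction go through at
      -- the quantifier, where f ∘ (x ∷ ρ) and f x ∷ f ∘ ρ are only pointwise equal.
      Sat-≈ : ∀ {n} (φ : Formula σ n) {ρ ρ′} → (∀ k → f (ρ k) N.≈ ρ′ k) → Sat M φ ρ ⇔ Sat N φ ρ′
      Sat-≈ falsum      e = mk⇔ id id
      Sat-≈ (s ≐′ t)    e = mk⇔
        (λ p → N.trans (N.sym (eval-≈ s e)) (N.trans (cong p) (eval-≈ t e)))
        (λ p → injective (N.trans (eval-≈ s e) (N.trans p (N.sym (eval-≈ t e)))))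
      Sat-≈ (atom r ts) e = mk⇔
        (λ p → N.rel-resp r (λ k → eval-≈ (ts k) e) (Equivalence.to (rel-homo r _) p))
        (λ p → Equivalence.from (rel-homo r _) (N.rel-resp r (λ k → N.sym (eval-≈ (ts k) e)) p))
      Sat-≈ (φ ⇒ ψ)     e = mk⇔
        (λ h p → Equivalence.to (Sat-≈ ψ e) (h (Equivalence.from (Sat-≈ φ e) p)))
        (λ h p → Equivalence.from (Sat-≈ ψ e) (h (Equivalence.to (Sat-≈ φ e) p)))
      Sat-≈ (all φ) {ρ} {ρ′} e = mk⇔
        (λ h y → let (x , q) = surjective y in Equivalence.to (Sat-≈ φ (extend q)) (h x))
        (λ h x → Equivalence.from (Sat-≈ φ (extend N.refl)) (h (f x)))
        where
        extend : ∀ {x y} → f x N.≈ y → ∀ k → f ((x ∷ ρ) k) N.≈ (y ∷ ρ′) k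
        extend q zero    = q
        extend q (suc k) = e k

      iso⇒elementary : IsElementary M N f
      iso⇒elementary φ ρ = Sat-≈ φ λ _ → N.refl

  Sat-resp : ∀ (M : Structure σ) {n} (φ : Formula σ n) {ρ ρ′} →
    (∀ k → Structure._≈_ M (ρ k) (ρ′ k)) → Sat M φ ρ ⇔ Sat M φ ρ′
  Sat-resp M = Sat-≈ M M {id} record
    { cong       = id
    ; injective  = id
    ; surjective = λ y → y , M.refl
    ; fun-homo   = λ _ _ → M.refl
    ; rel-homo   = λ _ _ → mk⇔ id id
    }
    where module M = Structure M

  ElementaryEmbedding-trans : ∀ {M N P : Structure σ} →
    ElementaryEmbedding M N → ElementaryEmbedding N P → ElementaryEmbedding M P
  ElementaryEmbedding-trans (f , f-elem) (g , g-elem) =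
    g ∘ f , λ φ ρ → g-elem φ _ ⇔-∘ f-elem φ ρ

  module _ {M N : Structure σ} (e : ElementaryEmbedding M N) where
    private
      module M = Structure M
      module N = Structure N
      f = proj₁ e
      f-elem = proj₂ e

    elementary-resp : ∀ {g} → (∀ x → f x N.≈ g x) → IsElementary M N g
    elementary-resp p φ ρ = Sat-resp N φ (λ k → p (ρ k)) ⇔-∘ f-elem φ ρ

    -- Truth in `M` at `g ∘ ρ` is truth in `N` at `f ∘ g ∘ ρ`, which equals `ρ`. This inverts
    -- isomorphisms without checking that the inverse is a homomorphism.
    ElementaryEmbedding-section : ∀ g → (∀ y → f (g y) N.≈ y) → ElementaryEmbedding N M
    ElementaryEmbedding-section g p =
      g , λ φ ρ → ⇔-sym (f-elem φ _) ⇔-∘ Sat-resp N φ (λ k → N.sym (p (ρ k)))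

    elementary⇒≈⇔ : ∀ x y → x M.≈ y ⇔ f x N.≈ f y
    elementary⇒≈⇔ x y = f-elem (var 0F ≐′ var 1F) (x ∷ y ∷ [])

    elementary⇒fun-homo : ∀ {n} (g : Signature.Fun σ n) xs →
      f (M.fun g xs) N.≈ N.fun g (f ∘ xs)
    elementary⇒fun-homo g xs = Equivalence.to
      (f-elem (var zero ≐′ app g (var ∘ suc)) (M.fun g xs ∷ xs)) M.refl

    elementary⇒injection : Injection M.setoid N.setoid
    elementary⇒injection = record
      { to        = f
      ; cong      = Equivalence.to (elementary⇒≈⇔ _ _)
      ; injective = Equivalence.from (elementary⇒≈⇔ _ _)
      }

-- Elementary embeddings of modules and the vanishing of `Ext¹`.

module _ {u} {R : Ring u u} where

  module _ (M N : Module R) {f : LeftModule.Carrierᴹ M → LeftModule.Carrierᴹ N} where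
    private
      module M = LeftModule M
      module N = LeftModule N

    mkIsIso :
      (∀ {x y} → x M.≈ᴹ y → f x N.≈ᴹ f y) →
      (∀ {x y} → f x N.≈ᴹ f y → x M.≈ᴹ y) →
      (∀ y → ∃[ x ] f x N.≈ᴹ y) →
      (∀ {n} (g : ModuleFun R n) xs →
        f (Structure.fun (asStructure R M) g xs) N.≈ᴹ Structure.fun (asStructure R N) g (f ∘ xs)) →
      IsIso R M N f
    mkIsIso f-cong f-inj f-surj f-fun = record
      { isLeftModuleMonomorphism = record
        { isLeftModuleHomomorphism = record
          { +ᴹ-isGroupHomomorphism = record
            { isMonoidHomomorphism = record
              { isMagmaHomomorphism = record
                { isRelHomomorphism = record { cong = f-cong }
                ; homo = λ x y → f-fun plus (x ∷ y ∷ [])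
                }
              ; ε-homo = f-fun zero []
              }
            ; ⁻¹-homo = λ x → f-fun minus (x ∷ [])
            }
          ; *ₗ-homo = λ r x → f-fun (scale r) (x ∷ [])
          }
        ; injective = f-inj
        }
      ; surjective = λ y → proj₁ (f-surj y) , λ p →
          N.≈ᴹ-trans (f-cong p) (proj₂ (f-surj y))
      }

  isIso⇒ElementaryEmbedding :
    (M N : Module R) {f : LeftModule.Carrierᴹ M → LeftModule.Carrierᴹ N} →
    IsIso R M N f → ElementaryEmbedding (asStructure R M) (asStructure R N)
  isIso⇒ElementaryEmbedding M N {f} f-iso =
    f , iso⇒elementary (asStructure R M) (asStructure R N) record
    { cong       = F.⟦⟧-cong
    ; injective  = F.injective
    ; surjective = λ y → proj₁ (F.surjective y) , proj₂ (F.surjective y) M.≈ᴹ-refl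
    ; fun-homo   = λ where
        zero      xs → F.0ᴹ-homo
        plus      xs → F.+ᴹ-homo _ _
        minus     xs → F.-ᴹ-homo _
        (scale r) xs → F.*ₗ-homo r _
    ; rel-homo   = λ ()
    }
    where
    module M = LeftModule M
    module F = IsLeftModuleIsomorphism f-iso

  module _ (M N : Module R) (e : ElementaryEmbedding (asStructure R M) (asStructure R N)) where
    private
      module M = LeftModule M
      module N = LeftModule N
      module F = Injection (elementary⇒injection e)
      f = proj₁ e
      f-fun : ∀ {n} (g : ModuleFun R n) xs → _
      f-fun = elementary⇒fun-homo e

    image : Submodule R N
    image = record
      { Member     = λ y → ∃[ x ] f x N.≈ᴹ y
      ; resp       = λ e (x , p) → x , N.≈ᴹ-trans p e
      ; 0-closed   = M.0ᴹ , f-fun zero []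
      ; +-closed   = λ (x , p) (y , q) → x M.+ᴹ y ,
          N.≈ᴹ-trans (f-fun plus (x ∷ y ∷ [])) (N.+ᴹ-cong p q)
      ; neg-closed = λ (x , p) → M.-ᴹ x , N.≈ᴹ-trans (f-fun minus (x ∷ [])) (N.-ᴹ‿cong p)
      ; *-closed   = λ r (x , p) → r M.*ₗ x ,
          N.≈ᴹ-trans (f-fun (scale r) (x ∷ [])) (N.*ₗ-cong (Ring.refl R) p)
      }

    private
      M′ = Submodule.toModule image

    toImage : M.Carrierᴹ → LeftModule.Carrierᴹ M′
    toImage x = f x , x , N.≈ᴹ-refl

    toImage-isIso : IsIso R M M′ toImage
    toImage-isIso = mkIsIso M M′ F.cong F.injective (λ (y , x , p) → x , p) λ where
      zero      xs → f-fun zero xs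
      plus      xs → f-fun plus xs
      minus     xs → f-fun minus xs
      (scale r) xs → f-fun (scale r) xs

    -- The inclusion is the inverse of `toImage` followed by `e`, both elementary; `elementary-resp`
    -- is applied because this holds only up to the equality of `N`.
    image-isElementary : IsElementarySubmodule R image
    image-isElementary = elementary-resp
      (ElementaryEmbedding-trans
        (ElementaryEmbedding-section (isIso⇒ElementaryEmbedding M M′ toImage-isIso)
          (λ (y , x , p) → x) (λ (y , x , p) → p))
        e)
      (λ (y , x , p) → p)

  -- Composing the projection with `h` turns an extension of `M` into one of `N`, which splits.
  -- Replacing the second coordinate of that splitting by `S.π` gives a splitting over `M`.
  Ext¹-vanishes-iso : (M N B : Module R) {h : LeftModule.Carrierᴹ M → LeftModule.Carrierᴹ N} →
    IsIso R M N h → Ext¹-vanishes R N B → Ext¹-vanishes R M B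
  Ext¹-vanishes-iso M N B {h} h-iso vanish S = record
    { f     = λ e → proj₁ (V.f e) , S.π e
    ; f-iso = mkIsIso S.E (Extension.E (0-Ext¹ R {M} {B}))
        (λ p → proj₁ (V.⟦⟧-cong p) , π.⟦⟧-cong p)
        (λ (p , q) → V.injective (p , N.≈ᴹ-trans (V.f-π _)
          (N.≈ᴹ-trans (h.⟦⟧-cong q) (N.≈ᴹ-sym (V.f-π _)))))
        (λ (b , m) → let (e , p) = V.surjective (b , h m); (p₁ , p₂) = p S.E.≈ᴹ-refl in
          e , p₁ , h.injective (N.≈ᴹ-trans (N.≈ᴹ-sym (V.f-π e)) p₂))
        λ where
          zero      xs → proj₁ V.0ᴹ-homo , π.0ᴹ-homo
          plus      xs → proj₁ (V.+ᴹ-homo _ _) , π.+ᴹ-homo _ _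
          minus     xs → proj₁ (V.-ᴹ-homo _) , π.-ᴹ-homo _
          (scale r) xs → proj₁ (V.*ₗ-homo r _) , π.*ₗ-homo r _
    ; f-ι   = λ c → proj₁ (V.f-ι c) , Equivalence.from (S.exact (S.ι c)) (c , S.E.≈ᴹ-refl)
    ; f-π   = λ e → M.≈ᴹ-refl
    }
    where
    module M = LeftModule M
    module N = LeftModule N
    module S = Extension S
    module π = IsLeftModuleHomomorphism S.π-hom
    module h = IsLeftModuleIsomorphism h-iso
    S′ : Extension R N B
    S′ = record
      { E      = S.E
      ; ι      = S.ι
      ; π      = h ∘ S.π
      ; ι-mono = S.ι-mono
      ; π-hom  = Composition.isLeftModuleHomomorphism N.≈ᴹ-trans S.π-hom h.isLeftModuleHomomorphism
      ; π-surj = λ n → let (m , p) = h.surjective n; (e , q) = S.π-surj m in e , p q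
      ; exact  = λ e → S.exact e ⇔-∘ mk⇔
          (λ p → h.injective (N.≈ᴹ-trans p (N.≈ᴹ-sym h.0ᴹ-homo)))
          (λ p → N.≈ᴹ-trans (h.⟦⟧-cong p) h.0ᴹ-homo)
      }
    module V where
      open _∼_ (vanish S′) public
      open IsLeftModuleIsomorphism f-iso public

  -- `M` is isomorphic to its image under `e`, an elementary submodule of `N` to which the closure
  -- hypothesis applies.
  Ext¹-vanishes-elementary : (M N B : Module R) →
    ClosedUnderElementarySubmodules R (⊥ˡ_ R ｛ B ｝) →
    ElementaryEmbedding (asStructure R M) (asStructure R N) →
    Ext¹-vanishes R N B → Ext¹-vanishes R M B
  Ext¹-vanishes-elementary M N B closed e vanish =
    Ext¹-vanishes-iso M (Submodule.toModule N′) B (toImage-isIso M N e)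
      (closed N N′ (λ { _ refl → vanish }) (image-isElementary M N e) B refl)
    where N′ = image M N e

-- Disjoint unions of setoids, as common upper bounds of sizes.

module _ {I : Set i} (X : I → Setoid c ℓ) where
  private
    module X i = Setoid (X i)

  data _≈⨄_ : Rel (∃ X.Carrier) (i ⊔ c ⊔ ℓ) where
    [_] : ∀ {k x y} → X._≈_ k x y → (k , x) ≈⨄ (k , y)

  ⨄ : Setoid (i ⊔ c) (i ⊔ c ⊔ ℓ)
  ⨄ = record
    { _≈_           = _≈⨄_
    ; isEquivalence = record
      { refl  = [ X.refl _ ]
      ; sym   = λ { [ p ] → [ X.sym _ p ] }
      ; trans = λ { [ p ] [ q ] → [ X.trans _ p q ] }
      }
    }

  ⨄-injection : ∀ k → Injection (X k) ⨄
  ⨄-injection k = record { to = k ,_ ; cong = [_] ; injective = λ { [ p ] → p } }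

-- Minimal modules and Vopěnka's principle.

module Vopěnka
  (em : ∀ {ℓ} → ExcludedMiddle ℓ) (ext : ∀ {a b} → Extensionality a b)
  {u : Level} (R : Ring u u)
  where

  open Classical em ext
  private
    module R = Ring R

  infix 4 _≲_ _≲≳_ _≺_

  size : Module R → Setoid u u
  size M = Structure.setoid (asStructure R M)

  _≲_ : Rel (Module R) u
  M ≲ N = Injection (size M) (size N)

  _≲≳_ : Rel (Module R) u
  M ≲≳ N = M ≲ N × N ≲ M

  ≲-trans : ∀ M N P → M ≲ N → N ≲ P → M ≲ P
  ≲-trans M N P = Compose.injection {R = size M} {size N} {size P}

  ≲≳-isEquivalence : IsEquivalence _≲≳_
  ≲≳-isEquivalence = record
    { refl  = λ {M} → Identity.injection (size M) , Identity.injection (size M)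
    ; sym   = λ (p , q) → q , p
    ; trans = λ {M} {N} {P} (p , q) (p′ , q′) → ≲-trans M N P p p′ , ≲-trans P N M q′ q
    }

  _≺_ : Rel (Module R) u
  M ≺ N = ElementaryEmbedding (asStructure R M) (asStructure R N)

  ≺-refl : ∀ M → M ≺ M
  ≺-refl M = id , λ φ ρ → mk⇔ id id

  ≺-trans : ∀ M N P → M ≺ N → N ≺ P → M ≺ P
  ≺-trans M N P =
    ElementaryEmbedding-trans {M = asStructure R M} {asStructure R N} {asStructure R P}

  -- Up to isomorphism these are the modules that inject into K, but they form a
  -- type at the level of K.
  record ModuleOn (K : Setoid u u) : Set u where
    private
      module K = Setoid K
    field
      domain       : Subset K.Carrier
      _+_          : (x y : ∃ (_∈ domain)) → ∃ (_∈ domain)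
      _*_          : R.Carrier → ∃ (_∈ domain) → ∃ (_∈ domain)
      0#           : ∃ (_∈ domain)
      -_           : ∃ (_∈ domain) → ∃ (_∈ domain)
      isLeftModule : IsLeftModule R (K._≈_ on proj₁) _+_ 0# -_ _*_

    toModule : Module R
    toModule = record { isLeftModule = isLeftModule }

  -- Transport of structure to the image of the injection. Boolean membership stores no preimage,
  -- but `∈⁻` extracts one from excluded middle, which makes `g` a choice of preimages. The module
  -- laws are then inherited along the monomorphism `g`.
  ModuleOn-represents : ∀ K M → Injection (size M) K →
    Σ[ N ∈ ModuleOn K ] M ≺ ModuleOn.toModule N × ModuleOn.toModule N ≺ M
  ModuleOn-represents K M M↣K =
    N , ElementaryEmbedding-section g≺ f gf , g≺
    where
    open Injection M↣K using (to; cong; injective)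
    module K = Setoid K
    module M = LeftModule M
    domain = ⟦ (λ k → ∃[ x ] to x K.≈ k) ⟧

    f : M.Carrierᴹ → ∃ (_∈ domain)
    f x = to x , ∈⁺ (x , K.refl)

    g : ∃ (_∈ domain) → M.Carrierᴹ
    g (_ , p) = proj₁ (∈⁻ p)

    fg : ∀ k → to (g k) K.≈ proj₁ k
    fg (_ , p) = proj₂ (∈⁻ p)

    gf : ∀ x → g (f x) M.≈ᴹ x
    gf x = injective (fg (f x))

    raw : RawLeftModule R.Carrier u u
    raw = record
      { Carrierᴹ = ∃ (_∈ domain)
      ; _≈ᴹ_     = K._≈_ on proj₁
      ; _+ᴹ_     = λ x y → f (g x M.+ᴹ g y)
      ; _*ₗ_     = λ r x → f (r M.*ₗ g x)
      ; 0ᴹ       = f M.0ᴹ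
      ; -ᴹ_      = λ x → f (M.-ᴹ g x)
      }

    g-isMono : IsLeftModuleMonomorphism raw M.rawLeftModule g
    g-isMono = record
      { isLeftModuleHomomorphism = record
        { +ᴹ-isGroupHomomorphism = record
          { isMonoidHomomorphism = record
            { isMagmaHomomorphism = record
              { isRelHomomorphism = record
                { cong = λ {x} {y} p → injective (K.trans (fg x) (K.trans p (K.sym (fg y)))) }
              ; homo = λ _ _ → gf _
              }
            ; ε-homo = gf _
            }
          ; ⁻¹-homo = λ _ → gf _
          }
        ; *ₗ-homo = λ _ _ → gf _
        }
      ; injective = λ {x} {y} p → K.trans (K.sym (fg x)) (K.trans (cong p) (fg y))
      }

    N : ModuleOn K
    N = record
      { domain = domain
      ; isLeftModule =
          LeftModuleMonomorphism.isLeftModule g-isMono R.isRing M.isLeftModule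
      }

    g≺ : ModuleOn.toModule N ≺ M
    g≺ = isIso⇒ElementaryEmbedding (ModuleOn.toModule N) M record
      { isLeftModuleMonomorphism = g-isMono
      ; surjective = λ x → f x , λ p →
          M.≈ᴹ-trans (IsLeftModuleMonomorphism.⟦⟧-cong g-isMono p) (gf x)
      }

  module _ (vp : VopěnkaPrinciple u) (𝒦 : Pred (Module R) a) where

    Minimal : Pred (Module R) _
    Minimal M = 𝒦 M × ∀ P → 𝒦 P → P ≺ M → M ≲ P

    -- `leastSetoid` accepts an index type of any level, so it applies to all members of `𝒦` below
    -- `M` at once. A least one is minimal because elementary embeddings compose.
    minimal-below : ∀ M → 𝒦 M → ∃[ N ] Minimal N × N ≺ M
    minimal-below M M∈𝒦 =
      below (leastSetoid {I = ∃[ N ] 𝒦 N × N ≺ M} (size ∘ proj₁) (M , M∈𝒦 , ≺-refl M))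
      where
      below : (∃[ N ] ∀ (P : ∃[ N ] 𝒦 N × N ≺ M) → proj₁ N ≲ proj₁ P) →
        ∃[ N ] Minimal N × N ≺ M
      below ((N , N∈𝒦 , N≺M) , least) =
        N , (N∈𝒦 , λ P P∈𝒦 P≺N → least (P , P∈𝒦 , ≺-trans P N M P≺N N≺M)) , N≺M

    -- Among representatives of the sizes of minimal modules there are no two that
    -- embed, since an embedding M ≺ N gives M ≲ N, and N ≲ M by minimality of N.
    minimal-bounded : ∃[ K ] ∀ M → Minimal M → Injection (size M) K
    minimal-bounded = bounded em
      where
      -- Vopěnka's principle yields members that are literally distinct, so modules of the same size
      -- must receive literally equal representatives.
      representatives = canonicalRepresentatives {A = ∃ Minimal} {_~_ = _≲≳_ on proj₁}
        (On.isEquivalence proj₁ ≲≳-isEquivalence)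
      r = proj₁ representatives

      r-≲≳ : ∀ m → proj₁ (r m) ≲≳ proj₁ m
      r-≲≳ = proj₁ (proj₂ representatives)

      r-cong : ∀ {m n} → proj₁ m ≲≳ proj₁ n → r m ≡ r n
      r-cong = proj₂ (proj₂ representatives)

      𝒮 : Pred (Structure (moduleSignature R)) _
      𝒮 = Range (λ m → asStructure R (proj₁ (r m)))

      embed⇒≡ : ∀ m n → proj₁ (r m) ≺ proj₁ (r n) → r m ≡ r n
      embed⇒≡ m n e = r-cong {m} {n} (E.trans {proj₁ m} {proj₁ (r m)} {proj₁ n}
        (E.sym {proj₁ (r m)} {proj₁ m} (r-≲≳ m))
        (E.trans {proj₁ (r m)} {proj₁ (r n)} {proj₁ n} rm≲≳rn (r-≲≳ n)))
        where
        module E = IsEquivalence ≲≳-isEquivalence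
        rm≲≳rn : proj₁ (r m) ≲≳ proj₁ (r n)
        rm≲≳rn = elementary⇒injection e , proj₂ (proj₂ (r n)) _ (proj₁ (proj₂ (r m))) e

      𝒮-isSet : ¬ IsProperClass u 𝒮
      𝒮-isSet proper with vp (moduleSignature R) 𝒮 proper
      ... | _ , _ , (m , refl) , (n , refl) , distinct , e =
        distinct (≡.cong (λ p → asStructure R (proj₁ p)) (embed⇒≡ m n e))

      bounded : Dec (IsSet u 𝒮) → ∃[ K ] ∀ M → Minimal M → Injection (size M) K
      bounded (no proper)             = contradiction proper 𝒮-isSet
      -- `M` injects into its representative, which is some `F k` and so injects into the disjoint
      -- union `K`.
      bounded (yes (I , F , 𝒮⊆F , _)) = K , λ M min →
        let (k , p) = 𝒮⊆F ((M , min) , refl) in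
        Compose.injection (proj₂ (r-≲≳ (M , min)))
          (≡.subst (λ S → Injection (Structure.setoid S) K) p (⨄-injection _ k))
        where K = ⨄ (λ k → Structure.setoid (F k))

    -- Each minimal module has an isomorphic copy on the one setoid `K`, and `up` keeps the copy in
    -- `𝒦`. `I` takes all modules on `K` that lie in `𝒦`; Boolean membership keeps it at level `u`,
    -- whatever the level of `𝒦`.
    small-coinitial : (∀ M N → 𝒦 M → M ≺ N → 𝒦 N) →
      Σ[ I ∈ Set u ] Σ[ F ∈ (I → Module R) ]
      (∀ k → 𝒦 (F k)) × (∀ M → 𝒦 M → ∃[ k ] F k ≺ M)
    small-coinitial up =
      I , (λ (N , _) → toModule N) , (λ (_ , p) → ∈⁻ p) , λ M M∈𝒦 → below M (minimal-below M M∈𝒦)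
      where
      open ModuleOn using (toModule)

      K : Setoid u u
      K = proj₁ minimal-bounded

      I : Set u
      I = ∃[ N ] N ∈ ⟦ 𝒦 ∘ toModule {K} ⟧

      below : ∀ M → ∃[ N ] Minimal N × N ≺ M → Σ[ k ∈ I ] toModule (proj₁ k) ≺ M
      below M (N , (N∈𝒦 , N-min) , N≺M) =
        let (N′ , N≺N′ , N′≺N) = ModuleOn-represents K N (proj₂ minimal-bounded N (N∈𝒦 , N-min))
        in (N′ , ∈⁺ (up N (toModule N′) N∈𝒦 N≺N′)) , ≺-trans (toModule N′) N M N′≺N N≺M

-- Cogeneration of the cotorsion pair.

corollary1p4 : (∀ {ℓ} → ExcludedMiddle ℓ) →
    (∀ {a b} → Extensionality a b) →
    ∀ {u : Level} → VopěnkaPrinciple u →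
    ∀ (R : Ring u u) {a b} (𝒜 : Pred (Module R) a) (ℬ : Pred (Module R) b) →
    IsCotorsionPair R 𝒜 ℬ →
    (∀ B → ℬ B → ClosedUnderElementarySubmodules R (⊥ˡ_ R ｛ B ｝)) →
    CogeneratedBySet R 𝒜 ℬ
corollary1p4 em ext vp R 𝒜 ℬ pair closed =
  Range B , (I , B , id , id) , (𝒜⊆ , ⊆𝒜) ,
  -- Once `𝒜` is the left orthogonal of `Range B`, the second equality is `right` rewritten.
  (λ Y∈ℬ M M∈⊥ → proj₁ right Y∈ℬ M (⊆𝒜 M∈⊥)) ,
  (λ Y∈ → proj₂ right λ M M∈𝒜 → Y∈ M (𝒜⊆ M∈𝒜))
  where
  open Classical em ext
  open Vopěnka em ext R
  open IsCotorsionPair pair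

  -- The closure hypothesis enters twice through this: to make the complement of `𝒜` upward closed,
  -- and to carry vanishing from `M` down to `F k` at the end.
  pullback : ∀ {M N B} → ℬ B → M ≺ N → Ext¹-vanishes R N B → Ext¹-vanishes R M B
  pullback {M} {N} {B} B∈ℬ = Ext¹-vanishes-elementary M N B (closed B B∈ℬ)

  ∁𝒜-upward : ∀ M N → ¬ 𝒜 M → M ≺ N → ¬ 𝒜 N
  ∁𝒜-upward M N M∉𝒜 M≺N N∈𝒜 =
    M∉𝒜 (proj₂ left λ B B∈ℬ → pullback {M} {N} B∈ℬ M≺N (proj₁ left N∈𝒜 B B∈ℬ))

  coinitial = small-coinitial vp (λ M → ¬ 𝒜 M) ∁𝒜-upward

  I = proj₁ coinitial

  F : I → Module R
  F = proj₁ (proj₂ coinitial)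

  F∉𝒜 : ∀ k → ¬ 𝒜 (F k)
  F∉𝒜 = proj₁ (proj₂ (proj₂ coinitial))

  F-coinitial : ∀ M → ¬ 𝒜 M → ∃[ k ] F k ≺ M
  F-coinitial = proj₂ (proj₂ (proj₂ coinitial))

  nonvanishing : ∀ k → ∃[ B ] ℬ B × ¬ Ext¹-vanishes R (F k) B
  nonvanishing k = stable λ n →
    F∉𝒜 k (proj₂ left λ B B∈ℬ → stable λ m → n (B , B∈ℬ , m))

  B : I → Module R
  B k = proj₁ (nonvanishing k)

  B∈ℬ : ∀ k → ℬ (B k)
  B∈ℬ k = proj₁ (proj₂ (nonvanishing k))

  𝒜⊆ : ∀ {M} → 𝒜 M → (⊥ˡ_ R (Range B)) M
  𝒜⊆ M∈𝒜 _ (k , refl) = proj₁ left M∈𝒜 (B k) (B∈ℬ k)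

  ⊆𝒜 : ∀ {M} → (⊥ˡ_ R (Range B)) M → 𝒜 M
  ⊆𝒜 {M} M∈⊥ = stable λ M∉𝒜 →
    let (k , Fk≺M) = F-coinitial M M∉𝒜
    in proj₂ (proj₂ (nonvanishing k)) (pullback {F k} {M} (B∈ℬ k) Fk≺M (M∈⊥ (B k) (k , refl)))
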